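{- Let $d\ge 1$ and let $\mu$ be a probability distribution on $Q_d$ such that for all $i\in[d]$ \[ w_i^0\geq \begin{cases}\frac34-\frac1{4d} & \text{if $d$ is odd},\\[2pt] \frac34-\frac1{4(d-1)} & \text{if $d$ is even}.\end{cases} \] Then $(\mathbf 0,\mathbf 0)$ is an equilibrium.
   Context: $Q_d=\{0,1\}^d$ with the Hamming distance $d(X,Y)=|\{i: x_i\neq y_i\}|$. A probability distribution on $Q_d$ is a function $\mu:Q_d\to\mathbb R_{\ge0}$ with $\sum_{V\in Q_d}\mu(V)=1$, extended to subsets by $\mu(\mathcal A)=\sum_{V\in\mathcal A}\mu(V)$. For $A,B\in Q_d$ let $V(A,B)=\{X\in Q_d: d(X,A)<d(X,B)\}$ and $T(A,B)=\{X\in Q_d: d(X,A)=d(X,B)\}$. The payoffs in position $(A,B)$ (Player 1 at $A$, Player 2 at $B$) are $P_1(A,B)=\mu(V(A,B))+\frac12\mu(T(A,B))$ and $P_2(A,B)=\mu(V(B,A))+\frac12\mu(T(A,B))$. The pair $(A,B)$ is an equilibrium if $P_1(A,B)\ge P_1(A',B)$ for all $A'\in Q_d$ and $P_2(A,B)\ge P_2(A,B')$ for all $B'\in Q_d$. For $i\in[d]$, $w_i^0=\mu(\{X\in Q_d: x_i=0\})$. $\mathbf 0=(0,\dots,0)$. -}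

module Defs where

open import Algebra.Bundles using (CommutativeMonoid)
import Algebra.Properties.CommutativeSemigroup as CommutativeSemigroupProperties
open import Data.Fin.Base using (Fin; zero)
open import Data.Fin.Properties using () renaming (_≟_ to _≟F_)
import Data.Integer.Base as ℤ
open import Data.List.Base using (List; []; _∷_; map; foldr; filter; length; allFin; cartesianProductWith)
open import Data.List.Membership.Propositional using (_∈_)
open import Data.List.Membership.Propositional.Properties using (∈-cartesianProductWith⁺; ∈-allFin)
open import Data.List.Relation.Unary.All using ([])
open import Data.List.Relation.Unary.Any using (here)
open import Data.List.Relation.Unary.Unique.Propositional using (Unique; []; _∷_)
open import Data.List.Relation.Unary.Unique.Propositional.Properties using (cartesianProductWith⁺; allFin⁺)
open import Data.Nat.Base as ℕ using (ℕ; NonZero)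
open import Data.Nat.Divisibility using (_∣_; _∣?_; ∣1⇒≡1)
import Data.Nat.Properties as ℕₚ
open import Data.Product.Base using (_×_; _,_; ∃-syntax)
open import Data.Rational.Base using (ℚ; 0ℚ; 1ℚ; ½; _+_; _-_; -_; _*_; _<_; _≤_; _/_; 1/_; ∣_∣; Positive) renaming (NonZero to ℚ-NonZero)
open import Data.Rational.Properties
open import Data.Vec.Base using (Vec; []; _∷_; lookup; replicate)
open import Data.Vec.Properties using (∷-injective)
open import Level using (0ℓ)
open import Relation.Binary.PropositionalEquality using (_≡_; refl; sym; trans; cong; subst)
open import Relation.Nullary.Decidable.Core using (yes; no; ¬?)
open import Relation.Nullary.Negation.Core using (contradiction)
open import Relation.Unary using (Pred; Decidable)

-- Real numbers: Cauchy sequences of rationals, taken up to _≈ℝ_.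

Cauchy : (ℕ → ℚ) → Set
Cauchy x = ∀ ε → 0ℚ < ε → ∃[ N ] (∀ m n → N ℕ.≤ m → N ℕ.≤ n → ∣ x m - x n ∣ < ε)

record ℝ : Set where
  constructor mkℝ
  field
    seq    : ℕ → ℚ
    cauchy : Cauchy seq

open ℝ public

infix 4 _≈ℝ_ _≤ℝ_

_≈ℝ_ : ℝ → ℝ → Set
x ≈ℝ y = ∀ ε → 0ℚ < ε → ∃[ N ] (∀ n → N ℕ.≤ n → ∣ seq x n - seq y n ∣ < ε)

_≤ℝ_ : ℝ → ℝ → Set
x ≤ℝ y = ∀ ε → 0ℚ < ε → ∃[ N ] (∀ n → N ℕ.≤ n → seq x n < seq y n + ε)

fromℚ : ℚ → ℝ
fromℚ q = mkℝ (λ _ → q) λ ε 0<ε → 0 , λ _ _ _ _ → subst (λ z → ∣ z ∣ < ε) (sym (+-inverseʳ q)) 0<ε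

private
  half-pos : ∀ {ε} → 0ℚ < ε → 0ℚ < ½ * ε
  half-pos {ε} 0<ε = subst (_< ½ * ε) (*-zeroʳ ½) (*-monoʳ-<-pos ½ 0<ε)

  halves : ∀ ε → ½ * ε + ½ * ε ≡ ε
  halves ε = trans (sym (*-distribʳ-+ ε ½ ½)) (*-identityˡ ε)

  +-interchange : ∀ a b c d → (a + b) - (c + d) ≡ (a - c) + (b - d)
  +-interchange a b c d = trans (cong (a + b +_) (neg-distrib-+ c d)) (interchange a b (- c) (- d))
    where open CommutativeSemigroupProperties (CommutativeMonoid.commutativeSemigroup +-0-commutativeMonoid) using (interchange)

  *-distrib-- : ∀ q a b → q * a - q * b ≡ q * (a - b)
  *-distrib-- q a b = trans (cong (q * a +_) (neg-distribʳ-* q b)) (sym (*-distribˡ-+ q a (- b)))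

infixl 6 _+ℝ_
infixl 7 _·ℝ_

_+ℝ_ : ℝ → ℝ → ℝ
x +ℝ y = mkℝ (λ n → seq x n + seq y n) λ ε 0<ε →
  let M , p = cauchy x (½ * ε) (half-pos 0<ε)
      N , q = cauchy y (½ * ε) (half-pos 0<ε)
  in M ℕ.⊔ N , λ m n h k → begin-strict
       ∣ (seq x m + seq y m) - (seq x n + seq y n) ∣
         ≡⟨ cong ∣_∣ (+-interchange (seq x m) (seq y m) (seq x n) (seq y n)) ⟩
       ∣ (seq x m - seq x n) + (seq y m - seq y n) ∣
         ≤⟨ ∣p+q∣≤∣p∣+∣q∣ (seq x m - seq x n) (seq y m - seq y n) ⟩
       ∣ seq x m - seq x n ∣ + ∣ seq y m - seq y n ∣
         <⟨ +-mono-< (p m n (ℕₚ.m⊔n≤o⇒m≤o M N h) (ℕₚ.m⊔n≤o⇒m≤o M N k))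
                     (q m n (ℕₚ.m⊔n≤o⇒n≤o M N h) (ℕₚ.m⊔n≤o⇒n≤o M N k)) ⟩
       ½ * ε + ½ * ε
         ≡⟨ halves ε ⟩
       ε ∎
  where open ≤-Reasoning

_·ℝ_ : ℚ → ℝ → ℝ
q ·ℝ x = mkℝ (λ n → q * seq x n) cauchy′
  where
  open ≤-Reasoning

  c : ℚ
  c = ∣ q ∣ + 1ℚ

  instance
    c-pos : Positive c
    c-pos = nonNeg+pos⇒pos ∣ q ∣ {{∣-∣-nonNeg q}} 1ℚ

    c-nonZero : ℚ-NonZero c
    c-nonZero = pos⇒nonZero c

    1/c-pos : Positive (1/ c)
    1/c-pos = 1/pos⇒pos c

  ∣q∣≤c : ∣ q ∣ ≤ c
  ∣q∣≤c = subst (_≤ c) (+-identityʳ ∣ q ∣) (+-monoʳ-≤ ∣ q ∣ (nonNegative⁻¹ 1ℚ))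

  cauchy′ : Cauchy (λ n → q * seq x n)
  cauchy′ ε 0<ε =
    let δ     = 1/ c * ε
        N , p = cauchy x δ (subst (_< δ) (*-zeroʳ (1/ c)) (*-monoʳ-<-pos (1/ c) 0<ε))
    in N , λ m n h k → begin-strict
         ∣ q * seq x m - q * seq x n ∣   ≡⟨ cong ∣_∣ (*-distrib-- q (seq x m) (seq x n)) ⟩
         ∣ q * (seq x m - seq x n) ∣     ≡⟨ ∣p*q∣≡∣p∣*∣q∣ q (seq x m - seq x n) ⟩
         ∣ q ∣ * ∣ seq x m - seq x n ∣   ≤⟨ *-monoʳ-≤-nonNeg ∣ seq x m - seq x n ∣ {{∣-∣-nonNeg (seq x m - seq x n)}} ∣q∣≤c ⟩
         c * ∣ seq x m - seq x n ∣       <⟨ *-monoʳ-<-pos c (p m n h k) ⟩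
         c * (1/ c * ε)                  ≡⟨ sym (*-assoc c (1/ c) ε) ⟩
         (c * 1/ c) * ε                  ≡⟨ cong (_* ε) (*-inverseʳ c) ⟩
         1ℚ * ε                          ≡⟨ *-identityˡ ε ⟩
         ε ∎

sumℝ : List ℝ → ℝ
sumℝ = foldr _+ℝ_ (fromℚ 0ℚ)

Q : ℕ → Set
Q d = Vec (Fin 2) d

𝟎 : ∀ {d} → Q d
𝟎 = replicate _ zero

vertices : ∀ d → List (Q d)
vertices ℕ.zero    = [] ∷ []
vertices (ℕ.suc d) = cartesianProductWith _∷_ (allFin 2) (vertices d)

vertices-complete : ∀ {d} (X : Q d) → X ∈ vertices d
vertices-complete []      = here refl
vertices-complete (x ∷ X) = ∈-cartesianProductWith⁺ _∷_ (∈-allFin x) (vertices-complete X)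

vertices-unique : ∀ d → Unique (vertices d)
vertices-unique ℕ.zero    = [] ∷ []
vertices-unique (ℕ.suc d) = cartesianProductWith⁺ _∷_ ∷-injective (allFin⁺ 2) (vertices-unique d)

dist : ∀ {d} → Q d → Q d → ℕ
dist {d} X Y = length (filter (λ i → ¬? (lookup X i ≟F lookup Y i)) (allFin d))

V : ∀ {d} → Q d → Q d → Pred (Q d) 0ℓ
V A B X = dist X A ℕ.< dist X B

T : ∀ {d} → Q d → Q d → Pred (Q d) 0ℓ
T A B X = dist X A ≡ dist X B

V? : ∀ {d} (A B : Q d) → Decidable (V A B)
V? A B X = dist X A ℕₚ.<? dist X B

T? : ∀ {d} (A B : Q d) → Decidable (T A B)
T? A B X = dist X A ℕₚ.≟ dist X B

record IsProbabilityDistribution {d} (μ : Q d → ℝ) : Set where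
  field
    nonNegative : ∀ X → fromℚ 0ℚ ≤ℝ μ X
    total       : sumℝ (map μ (vertices d)) ≈ℝ fromℚ 1ℚ

-- μ(𝒜), where the subset 𝒜 of Q d is given by a decision procedure for membership.
measure : ∀ {d} (μ : Q d → ℝ) {𝒜 : Pred (Q d) 0ℓ} → Decidable 𝒜 → ℝ
measure {d} μ 𝒜? = sumℝ (map μ (filter 𝒜? (vertices d)))

P₁ : ∀ {d} (μ : Q d → ℝ) → Q d → Q d → ℝ
P₁ μ A B = measure μ (V? A B) +ℝ ½ ·ℝ measure μ (T? A B)

P₂ : ∀ {d} (μ : Q d → ℝ) → Q d → Q d → ℝ
P₂ μ A B = measure μ (V? B A) +ℝ ½ ·ℝ measure μ (T? A B)

IsEquilibrium : ∀ {d} (μ : Q d → ℝ) → Q d → Q d → Set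
IsEquilibrium μ A B = (∀ A′ → P₁ μ A′ B ≤ℝ P₁ μ A B) × (∀ B′ → P₂ μ A B′ ≤ℝ P₂ μ A B)

w⁰ : ∀ {d} (μ : Q d → ℝ) → Fin d → ℝ
w⁰ μ i = measure μ {λ X → lookup X i ≡ zero} (λ X → lookup X i ≟F zero)

even⇒pred-nonZero : ∀ d → .{{NonZero d}} → 2 ∣ d → NonZero (d ℕ.∸ 1)
even⇒pred-nonZero (ℕ.suc ℕ.zero)    2∣1 = contradiction (∣1⇒≡1 2∣1) λ ()
even⇒pred-nonZero (ℕ.suc (ℕ.suc _)) _   = _

threshold : ∀ d → .{{NonZero d}} → ℚ
threshold d with 2 ∣? d
... | no  _   = ℤ.+ 3 / 4 - (ℤ.+ 1 / (4 ℕ.* d)) {{ℕₚ.m*n≢0 4 d}}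
... | yes 2∣d = ℤ.+ 3 / 4 - (ℤ.+ 1 / (4 ℕ.* (d ℕ.∸ 1))) {{ℕₚ.m*n≢0 4 (d ℕ.∸ 1) {{_}} {{even⇒pred-nonZero d 2∣d}}}}

{-# OPTIONS --safe #-}
module Submission where

-- Let A have support S of size k ≥ 1 and let x be the number of ones of v in S. Then v is closer to A than to 𝟎 iff
-- 2x > k, so 2P₁(A, 𝟎) is the expectation of g = 2·[2x > k] + [2x = k]. With m = d (d odd) or m = d − 1 (d even), the
-- threshold is t = 3/4 − 1/(4m), and g ≤ 4mx / (k(m + 1)) pointwise; the case k = m + 1 uses that k is then even.
-- Taking expectations, E x = Σ_{i ∈ S} (1 − wᵢ⁰) ≤ k(1 − t) = k(m + 1)/(4m), hence 2P₁(A, 𝟎) ≤ 1 = 2P₁(𝟎, 𝟎).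
-- Over Cauchy sequences this becomes a rational identity, at every index, writing a positive multiple of the payoff
-- difference as a combination with natural coefficients of sequences that are nonnegative in the limit.

open import Defs
open import Algebra.Bundles using (CommutativeRing)
open import Data.Bool.Base using (true; false; if_then_else_)
open import Data.Fin.Base using (Fin; zero; suc)
open import Data.Fin.Properties using (all?; ¬∀⟶∃¬) renaming (_≟_ to _≟F_)
import Data.Integer.Base as ℤ
import Data.Integer.Properties as ℤₚ
open import Data.List.Base using (List; []; _∷_; map; foldr; filter; length; allFin)
open import Data.List.Membership.Propositional.Properties using (∈-filter⁺; ∈-allFin; ∈-length)
open import Data.List.Properties using (filter-≐; length-filter; length-tabulate)
open import Data.Nat.Base as ℕ using (ℕ; zero; suc; NonZero; z≤n)
open import Data.Nat.Divisibility using (_∣_; _∣?_; divides; ∣1⇒≡1)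
import Data.Nat.Properties as ℕₚ
import Data.Nat.Solver as ℕ-Solver
open import Data.Product.Base using (_×_; _,_; ∃-syntax)
open import Data.Rational.Base using (ℚ; 0ℚ; 1ℚ; ½; _+_; _-_; -_; _*_; _<_; _≤_; _/_; ∣_∣; toℚᵘ; nonNegative)
open import Data.Rational.Properties
open import Data.Rational.Solver using (module +-*-Solver)
open import Data.Rational.Unnormalised.Base as ℚᵘ using (mkℚᵘ; *≡*)
import Data.Rational.Unnormalised.Properties as ℚᵘₚ
open import Data.Sum.Base using (_⊎_; inj₁; inj₂; [_,_]′)
open import Data.Vec.Base using ([]; _∷_; lookup)
open import Data.Vec.Properties using (lookup-replicate; tabulate∘lookup; tabulate-cong)
open import Function.Base using (_∘_)
open import Level using (0ℓ)
open import Relation.Binary.PropositionalEquality using (_≡_; refl; sym; trans; cong; cong₂; subst; module ≡-Reasoning)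
open import Relation.Nullary.Decidable using (Dec; does; yes; no; ¬?; dec-true; dec-false)
open import Relation.Nullary.Negation.Core using (contradiction)
open import Relation.Unary using (Pred; Decidable)

open import Algebra.Properties.Semiring.Mult (CommutativeRing.semiring +-*-commutativeRing) using (×-homo-+; ×1-homo-*) renaming (_×_ to _×ℚ_)

open ℕ-Solver.+-*-Solver using () renaming (solve to solveℕ; con to conℕ; _:=_ to _:≡_; _:+_ to _⊕_; _:*_ to _⊗_)
open +-*-Solver using (solve; con; _:=_; _:+_; _:-_; _:*_; :-_)

private
  variable
    X : Set

-- Natural numbers as rationals

-- As an iterated sum, `ι (suc n)` unfolds to `1ℚ + ι n`, which inductions and solver calls rely on.
ι : ℕ → ℚ
ι n = n ×ℚ 1ℚ

ι-homo-+ : ∀ m n → ι (m ℕ.+ n) ≡ ι m + ι n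
ι-homo-+ m n = ×-homo-+ 1ℚ m n

ι-homo-* : ∀ m n → ι (m ℕ.* n) ≡ ι m * ι n
ι-homo-* = ×1-homo-*

0≤ι : ∀ n → 0ℚ ≤ ι n
0≤ι zero    = ≤-refl
0≤ι (suc n) = +-mono-≤ (nonNegative⁻¹ 1ℚ) (0≤ι n)

toℚᵘ-ι : ∀ n → toℚᵘ (ι n) ℚᵘ.≃ mkℚᵘ (ℤ.+ n) 0
toℚᵘ-ι zero    = ℚᵘₚ.≃-refl
toℚᵘ-ι (suc n) = begin
  toℚᵘ (1ℚ + ι n)                ≈⟨ toℚᵘ-homo-+ 1ℚ (ι n) ⟩
  toℚᵘ 1ℚ ℚᵘ.+ toℚᵘ (ι n)        ≈⟨ ℚᵘₚ.+-congʳ (toℚᵘ 1ℚ) (toℚᵘ-ι n) ⟩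
  toℚᵘ 1ℚ ℚᵘ.+ mkℚᵘ (ℤ.+ n) 0    ≈⟨ *≡* (cong (ℤ._* ℤ.1ℤ) (cong (ℤ._+_ ℤ.1ℤ) (ℤₚ.*-identityʳ (ℤ.+ n)))) ⟩
  mkℚᵘ (ℤ.+ suc n) 0             ∎
  where open ℚᵘₚ.≃-Reasoning

-- The fraction is stored in lowest terms and does not compute for variable `n`; among unnormalised
-- rationals only a cross-multiplication in ℤ remains.
ι-*-1/ : ∀ n → .{{_ : NonZero n}} → ι n * (ℤ.+ 1 / n) ≡ 1ℚ
ι-*-1/ n@(suc n-1) = toℚᵘ-injective (begin
  toℚᵘ (ι n * (ℤ.+ 1 / n))                       ≈⟨ toℚᵘ-homo-* (ι n) (ℤ.+ 1 / n) ⟩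
  toℚᵘ (ι n) ℚᵘ.* toℚᵘ (ℤ.+ 1 / n)               ≈⟨ ℚᵘₚ.*-cong (toℚᵘ-ι n) (toℚᵘ-fromℚᵘ (mkℚᵘ (ℤ.+ 1) n-1)) ⟩
  mkℚᵘ (ℤ.+ n) 0 ℚᵘ.* mkℚᵘ (ℤ.+ 1) n-1           ≈⟨ *≡* (trans (cong (ℤ._* ℤ.1ℤ) (ℤₚ.*-identityʳ (ℤ.+ n))) (trans (ℤₚ.*-comm (ℤ.+ n) ℤ.1ℤ) (cong (λ j → ℤ.1ℤ ℤ.* ℤ.+ j) (sym (ℕₚ.*-identityˡ n))))) ⟩
  toℚᵘ 1ℚ                                        ∎)
  where open ℚᵘₚ.≃-Reasoning

-- Finite sums of rationals

Σ : List X → (X → ℚ) → ℚ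
Σ xs f = foldr (λ x a → f x + a) 0ℚ xs

Σ-cong : ∀ (xs : List X) {f g : X → ℚ} → (∀ x → f x ≡ g x) → Σ xs f ≡ Σ xs g
Σ-cong []       f≗g = refl
Σ-cong (x ∷ xs) f≗g = cong₂ _+_ (f≗g x) (Σ-cong xs f≗g)

Σ-distrib-+ : ∀ (xs : List X) (f g : X → ℚ) → Σ xs (λ x → f x + g x) ≡ Σ xs f + Σ xs g
Σ-distrib-+ []       f g = refl
Σ-distrib-+ (x ∷ xs) f g = trans (cong (f x + g x +_) (Σ-distrib-+ xs f g))
  (solve 4 (λ a b c e → a :+ b :+ (c :+ e) := a :+ c :+ (b :+ e)) refl (f x) (g x) (Σ xs f) (Σ xs g))

Σ-*ˡ : ∀ (xs : List X) c (f : X → ℚ) → Σ xs (λ x → c * f x) ≡ c * Σ xs f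
Σ-*ˡ []       c f = sym (*-zeroʳ c)
Σ-*ˡ (x ∷ xs) c f = trans (cong (c * f x +_) (Σ-*ˡ xs c f)) (sym (*-distribˡ-+ c (f x) (Σ xs f)))

Σ-const : ∀ (xs : List X) c → Σ xs (λ _ → c) ≡ ι (length xs) * c
Σ-const []       c = sym (*-zeroˡ c)
Σ-const (x ∷ xs) c = trans (cong (c +_) (Σ-const xs c))
  (solve 2 (λ n c → c :+ n :* c := (con 1ℚ :+ n) :* c) refl (ι (length xs)) c)

bit : {P : Set} → Dec P → ℕ
bit P? = if does P? then 1 else 0

Σ-filter : ∀ {P : Pred X 0ℓ} (P? : Decidable P) (f : X → ℚ) xs →
  Σ (filter P? xs) f ≡ Σ xs (λ x → ι (bit (P? x)) * f x)
Σ-filter P? f []       = refl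
Σ-filter P? f (x ∷ xs) with does (P? x)
... | true  = cong₂ _+_ (sym (*-identityˡ (f x))) (Σ-filter P? f xs)
... | false = trans (Σ-filter P? f xs) (trans (sym (+-identityˡ _)) (cong (_+ Σ xs (λ y → ι (bit (P? y)) * f y)) (sym (*-zeroˡ (f x)))))

-- Sequences that are nonnegative in the limit

infix 4 0≲_

-- Individual terms may be negative. No Cauchy condition is imposed, so bare sequences can be
-- combined without building reals.
0≲_ : (ℕ → ℚ) → Set
0≲ s = ∀ ε → 0ℚ < ε → ∃[ N ] (∀ n → N ℕ.≤ n → 0ℚ < s n + ε)

0≲-resp-≡ : ∀ {s t : ℕ → ℚ} → (∀ n → s n ≡ t n) → 0≲ s → 0≲ t
0≲-resp-≡ s≗t 0≲s ε 0<ε with N , p ← 0≲s ε 0<ε =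
  N , λ n N≤n → subst (λ z → 0ℚ < z + ε) (s≗t n) (p n N≤n)

0≲-0 : 0≲ (λ _ → 0ℚ)
0≲-0 ε 0<ε = 0 , λ _ _ → subst (0ℚ <_) (sym (+-identityˡ ε)) 0<ε

0≲-+ : ∀ {s t : ℕ → ℚ} → 0≲ s → 0≲ t → 0≲ (λ n → s n + t n)
0≲-+ {s} {t} 0≲s 0≲t ε 0<ε
  with M , p ← 0≲s (½ * ε) (subst (_< ½ * ε) (*-zeroʳ ½) (*-monoʳ-<-pos ½ 0<ε))
     | N , q ← 0≲t (½ * ε) (subst (_< ½ * ε) (*-zeroʳ ½) (*-monoʳ-<-pos ½ 0<ε)) =
  M ℕ.⊔ N , λ n h → subst (0ℚ <_)
    (solve 3 (λ a b e → (a :+ con ½ :* e) :+ (b :+ con ½ :* e) := a :+ b :+ e) refl (s n) (t n) ε)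
    (+-mono-< (p n (ℕₚ.m⊔n≤o⇒m≤o M N h)) (q n (ℕₚ.m⊔n≤o⇒n≤o M N h)))

-- A natural multiple is a repeated sum, so closure under `+` suffices.
0≲-ι* : ∀ k {s : ℕ → ℚ} → 0≲ s → 0≲ (λ n → ι k * s n)
0≲-ι* zero    {s} 0≲s = 0≲-resp-≡ (λ n → sym (*-zeroˡ (s n))) 0≲-0
0≲-ι* (suc k) {s} 0≲s = 0≲-resp-≡
  (λ n → solve 2 (λ a b → a :+ b :* a := (con 1ℚ :+ b) :* a) refl (s n) (ι k))
  (0≲-+ {s} {λ n → ι k * s n} 0≲s (0≲-ι* k 0≲s))

0≲-Σ : ∀ (xs : List X) {f : ℕ → X → ℚ} → (∀ x → 0≲ (λ n → f n x)) → 0≲ (λ n → Σ xs (f n))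
0≲-Σ []       0≲f = 0≲-0
0≲-Σ (x ∷ xs) {f} 0≲f = 0≲-+ {λ n → f n x} {λ n → Σ xs (f n)} (0≲f x) (0≲-Σ xs {f} 0≲f)

-- The same `ε` and `N` work: a nonnegative term needs nothing, and a nonpositive term is at least
-- its multiple by a positive natural.
0≲-cancel-ι* : ∀ k → .{{_ : NonZero k}} → ∀ {s : ℕ → ℚ} → 0≲ (λ n → ι k * s n) → 0≲ s
0≲-cancel-ι* (suc k) {s} 0≲ks ε 0<ε with N , p ← 0≲ks ε 0<ε = N , λ n N≤n → positive (s n) (p n N≤n)
  where
  positive : ∀ q → 0ℚ < ι (suc k) * q + ε → 0ℚ < q + ε
  positive q 0<kq+ε with ≤-total 0ℚ q
  ... | inj₁ 0≤q = +-mono-≤-< 0≤q 0<ε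
  ... | inj₂ q≤0 = <-≤-trans 0<kq+ε (+-monoˡ-≤ ε (begin
    (1ℚ + ι k) * q     ≡⟨ solve 2 (λ a b → (con 1ℚ :+ b) :* a := a :+ b :* a) refl q (ι k) ⟩
    q + ι k * q        ≤⟨ +-monoʳ-≤ q (*-monoˡ-≤-nonNeg (ι k) {{nonNegative (0≤ι k)}} q≤0) ⟩
    q + ι k * 0ℚ       ≡⟨ trans (cong (q +_) (*-zeroʳ (ι k))) (+-identityʳ q) ⟩
    q                  ∎))
    where open ≤-Reasoning

≤ℝ⇒0≲ : ∀ {x y} → x ≤ℝ y → 0≲ (λ n → seq y n - seq x n)
≤ℝ⇒0≲ {x} {y} x≤y ε 0<ε with N , p ← x≤y ε 0<ε = N , λ n N≤n →
  subst (_< seq y n - seq x n + ε) (+-inverseʳ (seq x n))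
    (subst (seq x n - seq x n <_)
      (solve 3 (λ x y e → y :+ e :- x := y :- x :+ e) refl (seq x n) (seq y n) ε)
      (+-monoˡ-< (- seq x n) (p n N≤n)))

0≲⇒≤ℝ : ∀ {x y} → 0≲ (λ n → seq y n - seq x n) → x ≤ℝ y
0≲⇒≤ℝ {x} {y} 0≲y-x ε 0<ε with N , p ← 0≲y-x ε 0<ε = N , λ n N≤n →
  subst (_< seq y n + ε) (+-identityˡ (seq x n))
    (subst (0ℚ + seq x n <_)
      (solve 3 (λ x y e → y :- x :+ e :+ x := y :+ e) refl (seq x n) (seq y n) ε)
      (+-monoˡ-< (seq x n) (p n N≤n)))

≈ℝ⇒≤ℝ : ∀ {x y} → x ≈ℝ y → x ≤ℝ y
≈ℝ⇒≤ℝ {x} {y} x≈y ε 0<ε with N , p ← x≈y ε 0<ε = N , λ n N≤n →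
  subst (_< seq y n + ε) (solve 2 (λ x y → y :+ (x :- y) := x) refl (seq x n) (seq y n))
    (+-monoʳ-< (seq y n) (≤-<-trans (p≤∣p∣ (seq x n - seq y n)) (p n N≤n)))
  where
  p≤∣p∣ : ∀ p → p ≤ ∣ p ∣
  p≤∣p∣ p with ≤-total 0ℚ p
  ... | inj₁ 0≤p = ≤-reflexive (sym (0≤p⇒∣p∣≡p 0≤p))
  ... | inj₂ p≤0 = ≤-trans p≤0 (0≤∣p∣ p)

seq-sumℝ : ∀ (μ : X → ℝ) xs n → seq (sumℝ (map μ xs)) n ≡ Σ xs (λ x → seq (μ x) n)
seq-sumℝ μ []       n = refl
seq-sumℝ μ (x ∷ xs) n = cong (seq (μ x) n +_) (seq-sumℝ μ xs n)

seq-measure : ∀ {d} (μ : Q d → ℝ) {𝒜 : Pred (Q d) 0ℓ} (𝒜? : Decidable 𝒜) n →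
  seq (measure μ 𝒜?) n ≡ Σ (vertices d) (λ v → ι (bit (𝒜? v)) * seq (μ v) n)
seq-measure {d} μ 𝒜? n = trans (seq-sumℝ μ (filter 𝒜? (vertices d)) n) (Σ-filter 𝒜? (λ v → seq (μ v) n) (vertices d))

-- Counting coordinates

ones : ∀ {d} → Q d → List (Fin d) → List (Fin d)
ones v = filter (λ i → ¬? (lookup v i ≟F zero))

-- On a coordinate where A is 0 the two distances agree; where A is 1 they differ by one, in favour of A iff v is 1 there.
dist-𝟎-dist : ∀ {d} (A v : Q d) →
  dist v 𝟎 ℕ.+ length (ones A (allFin d)) ≡ dist v A ℕ.+ 2 ℕ.* length (ones v (ones A (allFin d)))
-- Replacing `lookup 𝟎 i` by `zero` turns `dist v 𝟎` into a count of `ones v`; `go` then inducts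
-- over an arbitrary list of coordinates.
dist-𝟎-dist {d} A v = trans (cong (λ is → length is ℕ.+ length (ones A (allFin d)))
    (filter-≐ _ _ ((λ {i} v≢ v≡ → v≢ (trans v≡ (sym (lookup-replicate i zero)))) ,
                   (λ {i} v≢ v≡ → v≢ (trans v≡ (lookup-replicate i zero)))) (allFin d)))
  (go (allFin d))
  where
  diff : List (Fin d) → ℕ
  diff is = length (filter (λ i → ¬? (lookup v i ≟F lookup A i)) is)

  go : ∀ is → length (ones v is) ℕ.+ length (ones A is) ≡ diff is ℕ.+ 2 ℕ.* length (ones v (ones A is))
  go []       = refl
  go (i ∷ is) with lookup A i
  go (i ∷ is) | zero with lookup v i
  ... | zero     = go is
  ... | suc zero = cong suc (go is)
  go (i ∷ is) | suc zero with lookup v i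
  ... | zero     = trans (ℕₚ.+-suc _ _) (cong suc (go is))
  ... | suc zero = trans (solveℕ 2 (λ a b → conℕ 1 ⊕ a ⊕ (conℕ 1 ⊕ b) :≡ conℕ 2 ⊕ (a ⊕ b)) refl (length (ones v is)) (length (ones A is)))
    (trans (cong (2 ℕ.+_) (go is))
      (solveℕ 2 (λ a b → conℕ 2 ⊕ (a ⊕ conℕ 2 ⊗ b) :≡ a ⊕ conℕ 2 ⊗ (conℕ 1 ⊕ b)) refl (diff is) (length (ones v (ones A is)))))

-- Twice the share of a voter at v that Player 1 receives.
share : ∀ {d} → Q d → Q d → Q d → ℕ
share A B v = 2 ℕ.* bit (V? A B v) ℕ.+ bit (T? A B v)

share-self : ∀ {d} (A v : Q d) → share A A v ≡ 1
share-self A v = cong₂ (λ a<a a≡a → 2 ℕ.* (if a<a then 1 else 0) ℕ.+ (if a≡a then 1 else 0))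
  (dec-false (V? A A v) (ℕₚ.<-irrefl refl)) (dec-true (T? A A v) refl)

-- Markov's inequality in pointwise form.
share-bound : ∀ {d} (A v : Q d) m → let k = length (ones A (allFin d)) in
  .{{_ : NonZero m}} → k ℕ.≤ m ⊎ (k ≡ suc m × 2 ∣ k) →
  k ℕ.* suc m ℕ.* share A 𝟎 v ℕ.≤ 4 ℕ.* m ℕ.* length (ones v (ones A (allFin d)))
share-bound {d} A v m k≤m⊎even = bound (V? A 𝟎 v) (T? A 𝟎 v)
  where
  open ℕₚ.≤-Reasoning

  k x : ℕ
  k = length (ones A (allFin d))
  x = length (ones v (ones A (allFin d)))

  k*suc[m]≤2mx : k ℕ.< 2 ℕ.* x → k ℕ.≤ m ⊎ (k ≡ suc m × 2 ∣ k) → k ℕ.* suc m ℕ.≤ m ℕ.* (2 ℕ.* x)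
  k*suc[m]≤2mx k<2x (inj₁ k≤m) = begin
    k ℕ.* suc m        ≡⟨ ℕₚ.*-suc k m ⟩
    k ℕ.+ k ℕ.* m      ≤⟨ ℕₚ.+-monoˡ-≤ (k ℕ.* m) k≤m ⟩
    m ℕ.+ k ℕ.* m      ≡⟨ ℕₚ.*-comm (suc k) m ⟩
    m ℕ.* suc k        ≤⟨ ℕₚ.*-monoʳ-≤ m k<2x ⟩
    m ℕ.* (2 ℕ.* x)    ∎
  -- Here `k ≤ m` fails, but with `k` even, `k < 2x` improves to `k + 2 ≤ 2x`. This pays for the
  -- extra unit, since `suc m ≤ m + m`.
  k*suc[m]≤2mx k<2x (inj₂ (k≡suc[m] , divides j k≡j*2)) = begin
    k ℕ.* suc m            ≡⟨ ℕₚ.*-suc k m ⟩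
    k ℕ.+ k ℕ.* m          ≡⟨ cong (ℕ._+ k ℕ.* m) k≡suc[m] ⟩
    suc m ℕ.+ k ℕ.* m      ≤⟨ ℕₚ.+-monoˡ-≤ (k ℕ.* m) (ℕₚ.+-monoˡ-≤ m (ℕ.>-nonZero⁻¹ m)) ⟩
    m ℕ.+ m ℕ.+ k ℕ.* m    ≡⟨ cong (λ z → m ℕ.+ m ℕ.+ z ℕ.* m) k≡j*2 ⟩
    m ℕ.+ m ℕ.+ j ℕ.* 2 ℕ.* m  ≡⟨ solveℕ 2 (λ m j → m ⊕ m ⊕ j ⊗ conℕ 2 ⊗ m :≡ m ⊗ (conℕ 2 ⊗ (conℕ 1 ⊕ j))) refl m j ⟩
    m ℕ.* (2 ℕ.* suc j)    ≤⟨ ℕₚ.*-monoʳ-≤ m (ℕₚ.*-monoʳ-≤ 2 j<x) ⟩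
    m ℕ.* (2 ℕ.* x)        ∎
    where
    j<x : j ℕ.< x
    j<x = ℕₚ.*-cancelˡ-< 2 j x (subst (ℕ._< 2 ℕ.* x) (trans k≡j*2 (ℕₚ.*-comm j 2)) k<2x)

  bound : (a<b : Dec (V A 𝟎 v)) (a≡b : Dec (T A 𝟎 v)) → k ℕ.* suc m ℕ.* (2 ℕ.* bit a<b ℕ.+ bit a≡b) ℕ.≤ 4 ℕ.* m ℕ.* x
  bound (yes a<b) (yes a≡b) = contradiction a≡b (ℕₚ.<⇒≢ a<b)
  bound (yes a<b) (no _)    = begin
    k ℕ.* suc m ℕ.* 2      ≤⟨ ℕₚ.*-monoˡ-≤ 2 (k*suc[m]≤2mx k<2x k≤m⊎even) ⟩
    m ℕ.* (2 ℕ.* x) ℕ.* 2  ≡⟨ solveℕ 2 (λ m x → m ⊗ (conℕ 2 ⊗ x) ⊗ conℕ 2 :≡ conℕ 4 ⊗ m ⊗ x) refl m x ⟩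
    4 ℕ.* m ℕ.* x          ∎
    where
    k<2x : k ℕ.< 2 ℕ.* x
    k<2x = ℕₚ.+-cancelˡ-< (dist v A) k (2 ℕ.* x)
      (subst (dist v A ℕ.+ k ℕ.<_) (dist-𝟎-dist A v) (ℕₚ.+-monoˡ-< k a<b))
  bound (no _) (yes a≡b) = begin
    -- A tie means `k = 2x`, so `suc m ≤ m + m` is enough, whatever the parity of `k`.
    k ℕ.* suc m ℕ.* 1      ≤⟨ ℕₚ.*-monoˡ-≤ 1 (ℕₚ.*-monoʳ-≤ k (ℕₚ.+-monoˡ-≤ m (ℕ.>-nonZero⁻¹ m))) ⟩
    k ℕ.* (m ℕ.+ m) ℕ.* 1  ≡⟨ cong (λ z → z ℕ.* (m ℕ.+ m) ℕ.* 1) k≡2x ⟩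
    2 ℕ.* x ℕ.* (m ℕ.+ m) ℕ.* 1  ≡⟨ solveℕ 2 (λ m x → conℕ 2 ⊗ x ⊗ (m ⊕ m) ⊗ conℕ 1 :≡ conℕ 4 ⊗ m ⊗ x) refl m x ⟩
    4 ℕ.* m ℕ.* x          ∎
    where
    k≡2x : k ≡ 2 ℕ.* x
    k≡2x = ℕₚ.+-cancelˡ-≡ (dist v A) k (2 ℕ.* x)
      (trans (cong (ℕ._+ k) a≡b) (dist-𝟎-dist A v))
  bound (no _) (no _) = begin
    k ℕ.* suc m ℕ.* 0      ≡⟨ ℕₚ.*-zeroʳ (k ℕ.* suc m) ⟩
    0                      ≤⟨ z≤n ⟩
    4 ℕ.* m ℕ.* x          ∎

-- The threshold with denominators cleared

-- With M = `suc m`, the right side is 3M - 1, written without subtraction.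
scaled-threshold : ∀ m → ι (4 ℕ.* suc m) * (ℤ.+ 3 / 4 - (ℤ.+ 1 / (4 ℕ.* suc m))) ≡ ι (2 ℕ.+ 3 ℕ.* m)
scaled-threshold m = begin
  ι 4m * (ℤ.+ 3 / 4 - (ℤ.+ 1 / 4m))
    ≡⟨ solve 3 (λ a b c → a :* (b :- c) := a :* b :- a :* c) refl (ι 4m) (ℤ.+ 3 / 4) (ℤ.+ 1 / 4m) ⟩
  ι 4m * (ℤ.+ 3 / 4) - ι 4m * (ℤ.+ 1 / 4m)
    ≡⟨ cong₂ (λ a b → a * (ℤ.+ 3 / 4) - b) (ι-homo-* 4 (suc m)) (ι-*-1/ 4m) ⟩
  ι 4 * (1ℚ + ι m) * (ℤ.+ 3 / 4) - 1ℚ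
    ≡⟨ solve 1 (λ a → con (ι 4) :* (con 1ℚ :+ a) :* con (ℤ.+ 3 / 4) :- con 1ℚ := con (ι 2) :+ con (ι 3) :* a) refl (ι m) ⟩
  ι 2 + ι 3 * ι m
    ≡⟨ cong (ι 2 +_) (ι-homo-* 3 m) ⟨
  ι 2 + ι (3 ℕ.* m)
    ≡⟨ ι-homo-+ 2 (3 ℕ.* m) ⟨
  ι (2 ℕ.+ 3 ℕ.* m) ∎
  where
  open ≡-Reasoning
  4m = 4 ℕ.* suc m

-- Merges the parities: `suc m` is `d` for odd `d` and `d - 1` for even `d`. Only `k = d` can exceed
-- it, and then `k` is even.
threshold-spec : ∀ d → .{{_ : NonZero d}} → ∃[ m ]
  (ι (4 ℕ.* suc m) * threshold d ≡ ι (2 ℕ.+ 3 ℕ.* m) ×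
   (∀ {k} → k ℕ.≤ d → k ℕ.≤ suc m ⊎ (k ≡ suc (suc m) × 2 ∣ k)))
threshold-spec d with 2 ∣? d
threshold-spec (suc m)       | no  _   = m , scaled-threshold m , inj₁
threshold-spec (suc zero)    | yes 2∣1 = contradiction (∣1⇒≡1 2∣1) λ ()
threshold-spec (suc (suc m)) | yes 2∣d = m , scaled-threshold m , λ k≤d → [ inj₁ ∘ ℕ.s≤s⁻¹ , (λ { refl → inj₂ (refl , 2∣d) }) ]′ (ℕₚ.m≤n⇒m<n∨m≡n k≤d)

-- Expectations at a fixed index of the Cauchy sequences

module _ {d} (μ : Q d → ℝ) where

  total : ℕ → ℚ
  total n = Σ (vertices d) (λ v → seq (μ v) n)

  -- At a single index the weights may be negative and need not sum to 1, so `total n` stands in for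
  -- 1 in exact identities.
  expectation : (Q d → ℕ) → ℕ → ℚ
  expectation f n = Σ (vertices d) (λ v → ι (f v) * seq (μ v) n)

  0≲-expectation : (∀ v → fromℚ 0ℚ ≤ℝ μ v) → ∀ f → 0≲ expectation f
  -- `fromℚ 0ℚ ≤ℝ μ v` unfolds to `0≲ seq (μ v)`.
  0≲-expectation 0≤μ f = 0≲-Σ (vertices d) {λ n v → ι (f v) * seq (μ v) n} (λ v → 0≲-ι* (f v) {seq (μ v)} (0≤μ v))

  expectation-+ : ∀ f g n → expectation (λ v → f v ℕ.+ g v) n ≡ expectation f n + expectation g n
  expectation-+ f g n = trans
    (Σ-cong (vertices d) (λ v → trans (cong (_* seq (μ v) n) (ι-homo-+ (f v) (g v))) (*-distribʳ-+ (seq (μ v) n) (ι (f v)) (ι (g v)))))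
    (Σ-distrib-+ (vertices d) (λ v → ι (f v) * seq (μ v) n) (λ v → ι (g v) * seq (μ v) n))

  expectation-* : ∀ c f n → expectation (λ v → c ℕ.* f v) n ≡ ι c * expectation f n
  expectation-* c f n = trans
    (Σ-cong (vertices d) (λ v → trans (cong (_* seq (μ v) n) (ι-homo-* c (f v))) (*-assoc (ι c) (ι (f v)) (seq (μ v) n))))
    (Σ-*ˡ (vertices d) (ι c) _)

  expectation-const : ∀ c n → expectation (λ _ → c) n ≡ ι c * total n
  expectation-const c n = Σ-*ˡ (vertices d) (ι c) _

  expectation-cong : ∀ {f g : Q d → ℕ} → (∀ v → f v ≡ g v) → ∀ n → expectation f n ≡ expectation g n
  expectation-cong f≗g n = Σ-cong (vertices d) (λ v → cong (λ c → ι c * seq (μ v) n) (f≗g v))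

  seq-P₁ : ∀ A B n → seq (P₁ μ A B) n ≡ ½ * expectation (share A B) n
  seq-P₁ A B n = begin
    seq (measure μ (V? A B)) n + ½ * seq (measure μ (T? A B)) n
      ≡⟨ cong₂ (λ a b → a + ½ * b) (seq-measure μ (V? A B) n) (seq-measure μ (T? A B) n) ⟩
    𝔼V + ½ * 𝔼T
      ≡⟨ solve 2 (λ a b → a :+ con ½ :* b := con ½ :* (con (ι 2) :* a :+ b)) refl 𝔼V 𝔼T ⟩
    ½ * (ι 2 * 𝔼V + 𝔼T)
      ≡⟨ cong (λ a → ½ * (a + 𝔼T)) (expectation-* 2 (bit ∘ V? A B) n) ⟨
    ½ * (expectation (λ v → 2 ℕ.* bit (V? A B v)) n + 𝔼T)
      ≡⟨ cong (½ *_) (expectation-+ (λ v → 2 ℕ.* bit (V? A B v)) (bit ∘ T? A B) n) ⟨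
    ½ * expectation (share A B) n ∎
    where
    open ≡-Reasoning
    𝔼V = expectation (bit ∘ V? A B) n
    𝔼T = expectation (bit ∘ T? A B) n

  -- The game is symmetric; only the tie sets `T A B` and `T B A`, filtered by different tests, have
  -- to be identified.
  seq-P₂ : ∀ A B n → seq (P₂ μ A B) n ≡ ½ * expectation (share B A) n
  seq-P₂ A B n = trans (cong (λ vs → seq (measure μ (V? B A)) n + ½ * seq (sumℝ (map μ vs)) n) T-sym) (seq-P₁ B A n)
    where
    T-sym : filter (T? A B) (vertices d) ≡ filter (T? B A) (vertices d)
    T-sym = filter-≐ (T? A B) (T? B A) (sym , sym) (vertices d)

  expectation-share-self : ∀ A n → expectation (share A A) n ≡ total n
  expectation-share-self A n = trans (expectation-cong (share-self A) n) (trans (expectation-const 1 n) (*-identityˡ (total n)))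

  -- Linearity of expectation: each listed coordinate of a voter is either one or zero, so it
  -- contributes `total n` in all.
  expectation-ones : ∀ is n →
    expectation (λ v → length (ones v is)) n + Σ is (λ i → seq (w⁰ μ i) n) ≡ ι (length is) * total n
  expectation-ones []       n = trans (+-identityʳ _) (expectation-const 0 n)
  expectation-ones (i ∷ is) n = begin
    E (i ∷ is) + (w + W)
      ≡⟨ solve 3 (λ a b c → a :+ (b :+ c) := a :+ b :+ c) refl (E (i ∷ is)) w W ⟩
    E (i ∷ is) + w + W
      ≡⟨ cong (λ z → E (i ∷ is) + z + W) (seq-measure μ _ n) ⟩
    E (i ∷ is) + expectation zeros n + W
      ≡⟨ cong (_+ W) (expectation-+ (λ v → length (ones v (i ∷ is))) zeros n) ⟨
    expectation (λ v → length (ones v (i ∷ is)) ℕ.+ zeros v) n + W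
      ≡⟨ cong (_+ W) (expectation-cong ones-∷ n) ⟩
    expectation (λ v → 1 ℕ.+ length (ones v is)) n + W
      ≡⟨ cong (_+ W) (expectation-+ (λ _ → 1) (λ v → length (ones v is)) n) ⟩
    expectation (λ _ → 1) n + E is + W
      ≡⟨ cong (λ z → z + E is + W) (expectation-const 1 n) ⟩
    ι 1 * total n + E is + W
      ≡⟨ solve 3 (λ a b c → con 1ℚ :* a :+ b :+ c := a :+ (b :+ c)) refl (total n) (E is) W ⟩
    total n + (E is + W)
      ≡⟨ cong (total n +_) (expectation-ones is n) ⟩
    total n + ι (length is) * total n
      ≡⟨ solve 2 (λ a b → a :+ b :* a := (con 1ℚ :+ b) :* a) refl (total n) (ι (length is)) ⟩
    ι (length (i ∷ is)) * total n ∎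
    where
    open ≡-Reasoning
    E : List (Fin d) → ℚ
    E js = expectation (λ v → length (ones v js)) n

    W w : ℚ
    W = Σ is (λ j → seq (w⁰ μ j) n)
    w = seq (w⁰ μ i) n

    zeros : Q d → ℕ
    zeros v = bit (lookup v i ≟F zero)

    ones-∷ : ∀ v → length (ones v (i ∷ is)) ℕ.+ zeros v ≡ suc (length (ones v is))
    ones-∷ v with lookup v i
    ... | zero     = ℕₚ.+-comm (length (ones v is)) 1
    ... | suc zero = cong suc (ℕₚ.+-identityʳ (length (ones v is)))

-- The certificate against a deviation

≡𝟎⊎1≤ones : ∀ {d} (A : Q d) → A ≡ 𝟎 ⊎ 1 ℕ.≤ length (ones A (allFin d))
≡𝟎⊎1≤ones {d} A with all? (λ i → lookup A i ≟F zero)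
... | yes A≗0 = inj₁ (trans (sym (tabulate∘lookup A))
  (trans (tabulate-cong (λ i → trans (A≗0 i) (sym (lookup-replicate i zero)))) (tabulate∘lookup 𝟎)))
... | no ¬A≗0 with i , Aᵢ≢0 ← ¬∀⟶∃¬ d _ (λ i → lookup A i ≟F zero) ¬A≗0 =
  inj₂ (∈-length (∈-filter⁺ _ (∈-allFin i) Aᵢ≢0))

x+y≡z⇒x≡z-y : ∀ {x y z : ℚ} → x + y ≡ z → x ≡ z - y
x+y≡z⇒x≡z-y {x} {y} refl = solve 2 (λ x y → x := x :+ y :- y) refl x y

-- Matching the four equations with `refl` eliminates `σ`, `W`, `T`, `R` and leaves a polynomial
-- identity. The multiple of the excess cancels `E`; that of `1ℚ - s` cancels the constant
-- `a * k * t`.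
linear-identity : ∀ {σ W T R} a E k G s t →
  R ≡ a - a * t → σ ≡ a * E - k * R * G → W ≡ k * s - E → T ≡ a * t →
  σ + a * (W + k * - t) + k * T * (1ℚ - s) ≡ k * R * (s - G)
linear-identity a E k G s t refl refl refl refl =
  solve 6 (λ a E k G s t →
    a :* E :- k :* (a :- a :* t) :* G :+ a :* (k :* s :- E :+ k :* (:- t)) :+ k :* (a :* t) :* (con 1ℚ :- s)
    := k :* (a :- a :* t) :* (s :- G))
  refl a E k G s t

module _ d .{{_ : NonZero d}} (μ : Q d → ℝ) (isProb : IsProbabilityDistribution μ)
  (t≤w : (i : Fin d) → fromℚ (threshold d) ≤ℝ w⁰ μ i) where

  module Certificate (A : Q d) (1≤k : 1 ℕ.≤ length (ones A (allFin d))) m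
    (scaled : ι (4 ℕ.* suc m) * threshold d ≡ ι (2 ℕ.+ 3 ℕ.* m))
    (k-range : ∀ {k} → k ℕ.≤ d → k ℕ.≤ suc m ⊎ (k ≡ suc (suc m) × 2 ∣ k)) where

    S : List (Fin d)
    S = ones A (allFin d)

    k 4m K : ℕ
    k = length S
    4m = 4 ℕ.* suc m
    K = k ℕ.* suc (suc m)

    t : ℚ
    t = threshold d

    x gap : Q d → ℕ
    x v = length (ones v S)
    -- By `share-bound` the subtraction never truncates.
    gap v = 4m ℕ.* x v ℕ.∸ K ℕ.* share A 𝟎 v

    -- These are nonnegative in the limit by, respectively, the pointwise bound with `μ`
    -- nonnegative, the bounds on `w⁰`, and total mass 1.
    slack excess deficit : ℕ → ℚ
    slack = expectation μ gap
    excess n = Σ S (λ i → seq (w⁰ μ i) n - t)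
    deficit n = 1ℚ - seq (sumℝ (map μ (vertices d))) n

    k≤d : k ℕ.≤ d
    k≤d = subst (k ℕ.≤_) (length-tabulate {n = d} (λ i → i)) (length-filter _ (allFin d))

    gap-spec : ∀ v → gap v ℕ.+ K ℕ.* share A 𝟎 v ≡ 4m ℕ.* x v
    gap-spec v = ℕₚ.m∸n+n≡m (share-bound A v (suc m) (k-range k≤d))

    slack-spec : ∀ n → slack n + ι K * expectation μ (share A 𝟎) n ≡ ι 4m * expectation μ x n
    slack-spec n = begin
      slack n + ι K * expectation μ (share A 𝟎) n
        ≡⟨ cong (slack n +_) (expectation-* μ K (share A 𝟎) n) ⟨
      slack n + expectation μ (λ v → K ℕ.* share A 𝟎 v) n
        ≡⟨ expectation-+ μ gap (λ v → K ℕ.* share A 𝟎 v) n ⟨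
      expectation μ (λ v → gap v ℕ.+ K ℕ.* share A 𝟎 v) n
        ≡⟨ expectation-cong μ gap-spec n ⟩
      expectation μ (λ v → 4m ℕ.* x v) n
        ≡⟨ expectation-* μ 4m x n ⟩
      ι 4m * expectation μ x n ∎
      where open ≡-Reasoning

    -- With M = `suc m`, 1 - t = (M + 1)/(4M), which is exactly the ratio of the constants in
    -- `share-bound`.
    suc[m+1]≡4m-4mt : ι (suc (suc m)) ≡ ι 4m - ι 4m * t
    suc[m+1]≡4m-4mt = x+y≡z⇒x≡z-y (begin
      ι (suc (suc m)) + ι 4m * t                  ≡⟨ cong (ι (suc (suc m)) +_) scaled ⟩
      ι (suc (suc m)) + ι (2 ℕ.+ 3 ℕ.* m)         ≡⟨ ι-homo-+ (suc (suc m)) (2 ℕ.+ 3 ℕ.* m) ⟨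
      ι (suc (suc m) ℕ.+ (2 ℕ.+ 3 ℕ.* m))         ≡⟨ cong ι (solveℕ 1 (λ m → conℕ 2 ⊕ m ⊕ (conℕ 2 ⊕ conℕ 3 ⊗ m) :≡ conℕ 4 ⊗ (conℕ 1 ⊕ m)) refl m) ⟩
      ι 4m                                        ∎)
      where open ≡-Reasoning

    -- The `deficit` term corrects for `total μ n` differing from 1 at finite `n`; its coefficient
    -- is `k` times `4m * t`, a natural by `scaled`.
    certificate : ∀ n →
      slack n + ι 4m * excess n + ι (k ℕ.* (2 ℕ.+ 3 ℕ.* m)) * deficit n
      ≡ ι K * (total μ n - expectation μ (share A 𝟎) n)
    certificate n = begin
      slack n + ι 4m * excess n + ι (k ℕ.* (2 ℕ.+ 3 ℕ.* m)) * deficit n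
        ≡⟨ cong₂ (λ a b → slack n + ι 4m * a + b)
             (trans (Σ-distrib-+ S w (λ _ → - t)) (cong (Σ S w +_) (Σ-const S (- t))))
             (cong₂ (λ a b → a * (1ℚ - b)) (ι-homo-* k (2 ℕ.+ 3 ℕ.* m)) (seq-sumℝ μ (vertices d) n)) ⟩
      slack n + ι 4m * (Σ S w + ι k * - t) + ι k * ι (2 ℕ.+ 3 ℕ.* m) * (1ℚ - s)
        ≡⟨ linear-identity {slack n} {Σ S w} (ι 4m) (expectation μ x n) (ι k) G s t
             suc[m+1]≡4m-4mt
             (trans (x+y≡z⇒x≡z-y {slack n} {ι K * G} (slack-spec n)) (cong (λ a → ι 4m * expectation μ x n - a * G) (ι-homo-* k (suc (suc m)))))
             (x+y≡z⇒x≡z-y {Σ S w} {expectation μ x n} (trans (+-comm (Σ S w) (expectation μ x n)) (expectation-ones μ S n)))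
             (sym scaled) ⟩
      ι k * ι (suc (suc m)) * (s - G)
        ≡⟨ cong (_* (s - G)) (ι-homo-* k (suc (suc m))) ⟨
      ι K * (s - G) ∎
      where
      open ≡-Reasoning
      w : Fin d → ℚ
      w i = seq (w⁰ μ i) n

      G s : ℚ
      G = expectation μ (share A 𝟎) n
      s = total μ n

    0≲-excess : 0≲ excess
    0≲-excess = 0≲-Σ S {λ n i → seq (w⁰ μ i) n - t} (λ i → ≤ℝ⇒0≲ {fromℚ t} {w⁰ μ i} (t≤w i))

    0≲-deficit : 0≲ deficit
    0≲-deficit = ≤ℝ⇒0≲ {sumℝ (map μ (vertices d))} {fromℚ 1ℚ}
      (≈ℝ⇒≤ℝ {sumℝ (map μ (vertices d))} {fromℚ 1ℚ} (IsProbabilityDistribution.total isProb))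

    0≲-total-share-A : 0≲ (λ n → total μ n - expectation μ (share A 𝟎) n)
    -- Cancelling `K` requires `k` positive, which is why `A = 𝟎` is split off.
    0≲-total-share-A = 0≲-cancel-ι* K {{ℕₚ.m*n≢0 k (suc (suc m)) {{ℕ.>-nonZero 1≤k}}}}
      {λ n → total μ n - expectation μ (share A 𝟎) n}
      (0≲-resp-≡ certificate
        (0≲-+ {λ n → slack n + ι 4m * excess n} {λ n → ι (k ℕ.* (2 ℕ.+ 3 ℕ.* m)) * deficit n}
          (0≲-+ {slack} {λ n → ι 4m * excess n}
            (0≲-expectation μ (IsProbabilityDistribution.nonNegative isProb) gap)
            (0≲-ι* 4m {excess} 0≲-excess))
          (0≲-ι* (k ℕ.* (2 ℕ.+ 3 ℕ.* m)) {deficit} 0≲-deficit)))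

  0≲-total-share : ∀ A → 0≲ (λ n → total μ n - expectation μ (share A 𝟎) n)
  0≲-total-share A with ≡𝟎⊎1≤ones A | threshold-spec d
  ... | inj₁ refl | _ = 0≲-resp-≡ {λ _ → 0ℚ} {λ n → total μ n - expectation μ (share 𝟎 𝟎) n}
    (λ n → sym (trans (cong (λ a → total μ n - a) (expectation-share-self μ 𝟎 n)) (+-inverseʳ (total μ n))))
    0≲-0
  ... | inj₂ 1≤k  | m , scaled , k-range = Certificate.0≲-total-share-A A 1≤k m scaled k-range

  -- Stated for arbitrary reals with these sequences so that it serves both players; doubling
  -- removes the `½`.
  half-share-≤ : ∀ {x y} A → (∀ n → seq x n ≡ ½ * expectation μ (share A 𝟎) n) →
    (∀ n → seq y n ≡ ½ * expectation μ (share 𝟎 𝟎) n) → x ≤ℝ y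
  half-share-≤ {x} {y} A x≡ y≡ = 0≲⇒≤ℝ {x} {y} (0≲-cancel-ι* 2 {λ n → seq y n - seq x n}
    (0≲-resp-≡ doubled (0≲-total-share A)))
    where
    open ≡-Reasoning
    doubled : ∀ n → total μ n - expectation μ (share A 𝟎) n ≡ ι 2 * (seq y n - seq x n)
    doubled n = begin
      total μ n - G               ≡⟨ solve 2 (λ s g → s :- g := con (ι 2) :* (con ½ :* s :- con ½ :* g)) refl (total μ n) G ⟩
      ι 2 * (½ * total μ n - ½ * G)
        ≡⟨ cong₂ (λ a b → ι 2 * (a - b)) (trans (y≡ n) (cong (½ *_) (expectation-share-self μ 𝟎 n))) (x≡ n) ⟨
      ι 2 * (seq y n - seq x n)   ∎
      where
      G : ℚ
      G = expectation μ (share A 𝟎) n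

mainTheorem2 : (d : ℕ) → .{{_ : NonZero d}} → (μ : Q d → ℝ) → IsProbabilityDistribution μ →
    ((i : Fin d) → fromℚ (threshold d) ≤ℝ w⁰ μ i) →
    IsEquilibrium μ 𝟎 𝟎
mainTheorem2 d μ isProb t≤w =
  (λ A → half-share-≤ d μ isProb t≤w {P₁ μ A 𝟎} {P₁ μ 𝟎 𝟎} A (seq-P₁ μ A 𝟎) (seq-P₁ μ 𝟎 𝟎)) ,
  (λ B → half-share-≤ d μ isProb t≤w {P₂ μ 𝟎 B} {P₂ μ 𝟎 𝟎} B (seq-P₂ μ 𝟎 B) (seq-P₂ μ 𝟎 𝟎))
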